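{- Let $P$ be a level Eulerian poset whose underlying matrix $M$ is indecomposable. Then the order of the matrix $M$ (its number of rows) is even.
   Context: Level poset of a binary matrix: let $M$ be a $0/1$ square matrix with rows and columns indexed by a finite nonempty set $V$. The level poset of $M$ is the poset on $V\times\mathbb{Z}$ with $(u,i)<(v,j)$ if and only if $i<j$ and $(M^{j-i})_{u,v}>0$; the projection onto the second coordinate is its rank function, and $M$ is called its underlying matrix. A finite graded poset (with minimum, maximum and rank function $\rho$) is Eulerian if every interval $[x,y]$ in it of rank at least $1$ satisfies $\sum_{x\le z\le y}(-1)^{\rho(z)}=0$. A level poset is level Eulerian if every one of its intervals is Eulerian. A nonnegative square matrix $M$ is indecomposable if for all indices $i,j$ there is $t>0$ with $(M^t)_{i,j}>0$. -}

module Defs where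

import Algebra.Properties.Semiring.Sum as SemiringSum
open import Data.Empty using (⊥-elim)
open import Data.Fin.Base using (Fin; zero; suc)
import Data.Fin.Properties as Fin
open import Data.Integer.Base as ℤ using (ℤ; +_; ∣_∣; 0ℤ; 1ℤ; -1ℤ)
import Data.Integer.Properties as ℤ
open import Data.List.Base using (List; foldr; map; filter; upTo; allFin; cartesianProduct)
open import Data.List.Membership.Propositional using (_∈_)
open import Data.List.Membership.Propositional.Properties
  using (∈-filter⁺; ∈-filter⁻; ∈-cartesianProduct⁺; ∈-map⁺; ∈-upTo⁺; ∈-allFin)
open import Data.List.Relation.Unary.Unique.Propositional using (Unique)
import Data.List.Relation.Unary.Unique.Propositional.Properties as Unique
open import Data.Nat.Base as ℕ using (ℕ; zero; suc; s≤s; z≤n)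
import Data.Nat.Properties as ℕ
open import Data.Product.Base using (_×_; _,_; ∃-syntax; proj₁; proj₂)
open import Data.Product.Properties using (≡-dec)
open import Data.Sum.Base using (_⊎_; inj₁; inj₂)
open import Level using (0ℓ)
open import Relation.Binary.Core using (Rel)
open import Relation.Binary.Bundles using (Poset)
open import Relation.Binary.Definitions using (Decidable; Irreflexive; Transitive)
open import Relation.Binary.Structures using (IsStrictPartialOrder)
import Relation.Binary.Construct.StrictToNonStrict as StrictToNonStrict
open import Relation.Binary.PropositionalEquality hiding (poset)
open import Relation.Nullary.Decidable.Core using (yes; no; _×-dec_)
open import Relation.Nullary.Negation.Core using (¬_)

open SemiringSum ℕ.+-*-semiring public using (sum; sum-syntax)

Matrix : ℕ → Set
Matrix n = Fin n → Fin n → ℕ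

infixl 7 _⊛_
infixr 8 _⊛^_

_⊛_ : ∀ {n} → Matrix n → Matrix n → Matrix n
_⊛_ {n} A B u w = ∑[ v < n ] (A u v ℕ.* B v w)

identity : ∀ {n} → Matrix n
identity u v with u Fin.≟ v
... | yes _ = 1
... | no  _ = 0

_⊛^_ : ∀ {n} → Matrix n → ℕ → Matrix n
M ⊛^ zero  = identity
M ⊛^ suc k = M ⊛ (M ⊛^ k)

IsBinary : ∀ {n} → Matrix n → Set
IsBinary M = ∀ u v → M u v ≡ 0 ⊎ M u v ≡ 1

Indecomposable : ∀ {n} → Matrix n → Set
Indecomposable M = ∀ u v → ∃[ t ] (0 ℕ.< t × 0 ℕ.< (M ⊛^ t) u v)

-- Posets here are locally finite: interval x y lists each z with x ≤ z ≤ y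
-- exactly once, so that sums over intervals can be formed.
record GradedPoset : Set₁ where
  infix 4 _<_ _≤_ _⋖_
  field
    Carrier              : Set
    _<_                  : Rel Carrier 0ℓ
    isStrictPartialOrder : IsStrictPartialOrder _≡_ _<_

  _≤_ : Rel Carrier 0ℓ
  _≤_ = StrictToNonStrict._≤_ _≡_ _<_

  _⋖_ : Rel Carrier 0ℓ
  x ⋖ y = x < y × (∀ z → ¬ (x < z × z < y))

  poset : Poset 0ℓ 0ℓ 0ℓ
  poset = record
    { isPartialOrder = StrictToNonStrict.isPartialOrder _≡_ _<_ isStrictPartialOrder }

  field
    rank            : Carrier → ℤ
    rank-mono       : ∀ {x y} → x < y → rank x ℤ.< rank y
    rank-cover      : ∀ {x y} → x ⋖ y → rank y ≡ rank x ℤ.+ 1ℤ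
    interval        : Carrier → Carrier → List Carrier
    interval-unique : ∀ x y → Unique (interval x y)
    ∈-interval⁺     : ∀ {x y z} → x ≤ z → z ≤ y → z ∈ interval x y
    ∈-interval⁻     : ∀ {x y z} → z ∈ interval x y → x ≤ z × z ≤ y

-- (-1)^k for an integer exponent: k and ∣ k ∣ have the same parity.
sign : ℤ → ℤ
sign k = -1ℤ ℤ.^ ∣ k ∣

module _ (P : GradedPoset) where
  open GradedPoset P

  alternatingSum : Carrier → Carrier → ℤ
  alternatingSum x y = foldr ℤ._+_ 0ℤ (map (λ z → sign (rank z)) (interval x y))

  -- The interval [a , b], viewed as a finite graded poset, is Eulerian.  Its
  -- own intervals are the [x , y] with a ≤ x ≤ y ≤ b.  Its rank function is
  -- used without shifting rank a to 0, which only affects the global sign of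
  -- the sum.
  EulerianInterval : Carrier → Carrier → Set
  EulerianInterval a b = ∀ x y → a ≤ x → x ≤ y → y ≤ b →
                         1ℤ ℤ.≤ rank y ℤ.- rank x → alternatingSum x y ≡ 0ℤ

  AllIntervalsEulerian : Set
  AllIntervalsEulerian = ∀ a b → a ≤ b → EulerianInterval a b

sum-pos⁺ : ∀ {n} (f : Fin n → ℕ) i → 0 ℕ.< f i → 0 ℕ.< sum f
sum-pos⁺ f zero    p = ℕ.<-≤-trans p (ℕ.m≤m+n _ _)
sum-pos⁺ f (suc i) p = ℕ.<-≤-trans (sum-pos⁺ (λ j → f (suc j)) i p) (ℕ.m≤n+m _ (f zero))

sum-pos⁻ : ∀ {n} (f : Fin n → ℕ) → 0 ℕ.< sum f → ∃[ i ] 0 ℕ.< f i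
sum-pos⁻ {suc n} f p with f zero in eq
... | suc _ = zero , subst (0 ℕ.<_) (sym eq) (s≤s z≤n)
... | zero  with i , q ← sum-pos⁻ (λ j → f (suc j)) p = suc i , q

*-pos⁻ : ∀ a b → 0 ℕ.< a ℕ.* b → 0 ℕ.< a × 0 ℕ.< b
*-pos⁻ (suc a) (suc b) p = s≤s z≤n , s≤s z≤n
*-pos⁻ (suc a) zero    p = ⊥-elim (ℕ.<-irrefl (sym (ℕ.*-zeroʳ a)) p)

module _ {n : ℕ} where

  ⊛-pos⁺ : ∀ (A B : Matrix n) {u v w} → 0 ℕ.< A u v → 0 ℕ.< B v w → 0 ℕ.< (A ⊛ B) u w
  ⊛-pos⁺ A B {u} {v} {w} p q = sum-pos⁺ (λ x → A u x ℕ.* B x w) v (ℕ.*-mono-< p q)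

  ⊛-pos⁻ : ∀ (A B : Matrix n) {u w} → 0 ℕ.< (A ⊛ B) u w → ∃[ v ] (0 ℕ.< A u v × 0 ℕ.< B v w)
  ⊛-pos⁻ A B {u} {w} p with v , q ← sum-pos⁻ (λ x → A u x ℕ.* B x w) p = v , *-pos⁻ _ _ q

  identity-pos⁺ : ∀ (u : Fin n) → 0 ℕ.< identity u u
  identity-pos⁺ u with u Fin.≟ u
  ... | yes _  = s≤s z≤n
  ... | no u≢u = ⊥-elim (u≢u refl)

  identity-pos⁻ : ∀ (u v : Fin n) → 0 ℕ.< identity u v → u ≡ v
  identity-pos⁻ u v p with u Fin.≟ v
  ... | yes u≡v = u≡v

  ⊛^-pos : ∀ (M : Matrix n) a b {u v w} →
           0 ℕ.< (M ⊛^ a) u v → 0 ℕ.< (M ⊛^ b) v w → 0 ℕ.< (M ⊛^ (a ℕ.+ b)) u w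
  ⊛^-pos M zero    b {u} {v} {w} p q = subst (λ x → 0 ℕ.< (M ⊛^ b) x w) (sym (identity-pos⁻ u v p)) q
  ⊛^-pos M (suc a) b p q with x , r , s ← ⊛-pos⁻ M (M ⊛^ a) p =
    ⊛-pos⁺ M (M ⊛^ (a ℕ.+ b)) r (⊛^-pos M a b s q)

+∣j-i∣ : ∀ {i j} → i ℤ.≤ j → + ∣ j ℤ.- i ∣ ≡ j ℤ.- i
+∣j-i∣ i≤j = ℤ.0≤i⇒+∣i∣≡i (ℤ.i≤j⇒0≤j-i i≤j)

i+[j-i] : ∀ i j → i ℤ.+ (j ℤ.- i) ≡ j
i+[j-i] i j = trans (cong (λ z → i ℤ.+ z) (ℤ.+-comm j (ℤ.- i)))
  (trans (sym (ℤ.+-assoc i (ℤ.- i) j))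
  (trans (cong (λ z → z ℤ.+ j) (ℤ.+-inverseʳ i)) (ℤ.+-identityˡ j)))

i+∣j-i∣ : ∀ {i j} → i ℤ.≤ j → i ℤ.+ + ∣ j ℤ.- i ∣ ≡ j
i+∣j-i∣ {i} {j} i≤j = trans (cong (λ z → i ℤ.+ z) (+∣j-i∣ i≤j)) (i+[j-i] i j)

∣-∣-additive : ∀ {i j k} → i ℤ.≤ j → j ℤ.≤ k →
               ∣ k ℤ.- i ∣ ≡ ∣ j ℤ.- i ∣ ℕ.+ ∣ k ℤ.- j ∣
∣-∣-additive {i} {j} {k} i≤j j≤k = ℤ.+-injective (begin
  + ∣ k ℤ.- i ∣                           ≡⟨ +∣j-i∣ (ℤ.≤-trans i≤j j≤k) ⟩
  k ℤ.- i                                 ≡⟨ cong (λ z → z ℤ.- i) (i+[j-i] j k) ⟨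
  (j ℤ.+ (k ℤ.- j)) ℤ.- i                 ≡⟨ ℤ.+-assoc j (k ℤ.- j) (ℤ.- i) ⟩
  j ℤ.+ ((k ℤ.- j) ℤ.- i)                 ≡⟨ cong (λ z → j ℤ.+ z) (ℤ.+-comm (k ℤ.- j) (ℤ.- i)) ⟩
  j ℤ.+ (ℤ.- i ℤ.+ (k ℤ.- j))             ≡⟨ ℤ.+-assoc j (ℤ.- i) (k ℤ.- j) ⟨
  (j ℤ.- i) ℤ.+ (k ℤ.- j)                 ≡⟨ cong₂ ℤ._+_ (+∣j-i∣ i≤j) (+∣j-i∣ j≤k) ⟨
  + (∣ j ℤ.- i ∣ ℕ.+ ∣ k ℤ.- j ∣)         ∎)
  where open ≡-Reasoning

∣[i+m]-i∣ : ∀ i m → ∣ (i ℤ.+ + m) ℤ.- i ∣ ≡ m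
∣[i+m]-i∣ i m = cong ∣_∣ (trans (ℤ.+-assoc i (+ m) (ℤ.- i)) (trans (cong (λ z → i ℤ.+ z) (ℤ.+-comm (+ m) (ℤ.- i)))
  (trans (sym (ℤ.+-assoc i (ℤ.- i) (+ m))) (trans (cong (λ z → z ℤ.+ + m) (ℤ.+-inverseʳ i)) (ℤ.+-identityˡ (+ m))))))

i<i+1 : ∀ i → i ℤ.< i ℤ.+ 1ℤ
i<i+1 i = subst (ℤ._< i ℤ.+ 1ℤ) (ℤ.+-identityʳ i) (ℤ.+-monoʳ-< i (ℤ.+<+ (s≤s z≤n)))

levels : ℤ → ℤ → List ℤ
levels i j = map (λ k → i ℤ.+ + k) (upTo (suc ∣ j ℤ.- i ∣))

module _ {n : ℕ} (M : Matrix n) where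

  LevelElement : Set
  LevelElement = Fin n × ℤ

  infix 4 _<ₗ_ _≤ₗ_

  -- The exponent j - i is positive whenever the first component holds, so
  -- ∣ j - i ∣ is just j - i as a natural number.
  _<ₗ_ : Rel LevelElement 0ℓ
  (u , i) <ₗ (v , j) = i ℤ.< j × 0 ℕ.< (M ⊛^ ∣ j ℤ.- i ∣) u v

  _≤ₗ_ : Rel LevelElement 0ℓ
  _≤ₗ_ = StrictToNonStrict._≤_ _≡_ _<ₗ_

  <ₗ-irrefl : Irreflexive _≡_ _<ₗ_
  <ₗ-irrefl refl (i<i , _) = ℤ.<-irrefl refl i<i

  <ₗ-trans : Transitive _<ₗ_
  <ₗ-trans {u , i} {v , j} {w , k} (i<j , p) (j<k , q) =
    ℤ.<-trans i<j j<k ,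
    subst (λ d → 0 ℕ.< (M ⊛^ d) u w) (sym (∣-∣-additive (ℤ.<⇒≤ i<j) (ℤ.<⇒≤ j<k)))
      (⊛^-pos M ∣ j ℤ.- i ∣ ∣ k ℤ.- j ∣ p q)

  <ₗ-isStrictPartialOrder : IsStrictPartialOrder _≡_ _<ₗ_
  <ₗ-isStrictPartialOrder = record
    { isEquivalence = isEquivalence
    ; irrefl        = <ₗ-irrefl
    ; trans         = λ {x} {y} {z} → <ₗ-trans {x} {y} {z}
    ; <-resp-≈      = resp₂ _<ₗ_
    }

  _<ₗ?_ : Decidable _<ₗ_
  (u , i) <ₗ? (v , j) = (i ℤ.<? j) ×-dec (0 ℕ.<? (M ⊛^ ∣ j ℤ.- i ∣) u v)

  _≤ₗ?_ : Decidable _≤ₗ_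
  _≤ₗ?_ = StrictToNonStrict.decidable _≡_ _<ₗ_ (≡-dec Fin._≟_ ℤ._≟_) _<ₗ?_

  ≤ₗ⇒level≤ : ∀ {x y} → x ≤ₗ y → proj₂ x ℤ.≤ proj₂ y
  ≤ₗ⇒level≤ (inj₁ (i<j , _)) = ℤ.<⇒≤ i<j
  ≤ₗ⇒level≤ (inj₂ refl)      = ℤ.≤-refl

  cover : ∀ u v i d → 0 ℕ.< (M ⊛^ suc d) u v →
          (∀ z → ¬ ((u , i) <ₗ z × z <ₗ (v , i ℤ.+ + suc d))) → d ≡ 0
  cover u v i zero    p no-between = refl
  cover u v i (suc d) p no-between with w , q , r ← ⊛-pos⁻ M (M ⊛^ suc d) p =
    ⊥-elim (no-between (w , i ℤ.+ 1ℤ)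
      ( (i<i+1 i , subst (λ e → 0 ℕ.< (M ⊛^ e) u w) (sym (∣[i+m]-i∣ i 1)) (⊛-pos⁺ M identity q (identity-pos⁺ w)))
      , (ℤ.+-monoʳ-< i (ℤ.+<+ (s≤s (s≤s z≤n)))
        , subst (λ e → 0 ℕ.< (M ⊛^ e) w v) (sym gap) r) ))
    where
    gap : ∣ (i ℤ.+ + suc (suc d)) ℤ.- (i ℤ.+ 1ℤ) ∣ ≡ suc d
    gap = trans (cong (λ x → ∣ x ℤ.- (i ℤ.+ 1ℤ) ∣) (sym (ℤ.+-assoc i 1ℤ (+ suc d)))) (∣[i+m]-i∣ (i ℤ.+ 1ℤ) (suc d))

  level-cover : ∀ x y → x <ₗ y → (∀ z → ¬ (x <ₗ z × z <ₗ y)) → proj₂ y ≡ proj₂ x ℤ.+ 1ℤ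
  level-cover (u , i) (v , j) (i<j , p) no-between
    with ∣ j ℤ.- i ∣ | i+∣j-i∣ (ℤ.<⇒≤ i<j)
  ... | zero  | eq   = ⊥-elim (ℤ.<-irrefl (trans (sym (ℤ.+-identityʳ i)) eq) i<j)
  ... | suc d | refl = cong (λ e → i ℤ.+ + suc e) (cover u v i d p no-between)

  levels-unique : ∀ i j → Unique (levels i j)
  levels-unique i j = Unique.map⁺ (λ {k} {l} eq → trans (sym (∣[i+m]-i∣ i k))
                                     (trans (cong (λ m → ∣ m ℤ.- i ∣) eq) (∣[i+m]-i∣ i l)))
                                  (Unique.upTo⁺ _)

  ∈-levels : ∀ {i j k} → i ℤ.≤ k → k ℤ.≤ j → k ∈ levels i j
  ∈-levels {i} {j} {k} i≤k k≤j = subst (_∈ levels i j) (i+∣j-i∣ i≤k)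
    (∈-map⁺ (λ l → i ℤ.+ + l) (∈-upTo⁺ (s≤s (subst (∣ k ℤ.- i ∣ ℕ.≤_) (sym (∣-∣-additive i≤k k≤j)) (ℕ.m≤m+n _ _)))))

  levelInterval : LevelElement → LevelElement → List LevelElement
  levelInterval x y =
    filter (λ z → (x ≤ₗ? z) ×-dec (z ≤ₗ? y))
           (cartesianProduct (allFin n) (levels (proj₂ x) (proj₂ y)))

  levelPoset : GradedPoset
  levelPoset = record
    { Carrier              = LevelElement
    ; _<_                  = _<ₗ_
    ; isStrictPartialOrder = <ₗ-isStrictPartialOrder
    ; rank                 = proj₂
    ; rank-mono            = proj₁
    ; rank-cover           = λ {x} {y} (x<y , no-between) → level-cover x y x<y no-between
    ; interval             = levelInterval
    ; interval-unique      = λ x y → Unique.filter⁺ (λ z → (x ≤ₗ? z) ×-dec (z ≤ₗ? y))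
                               (Unique.cartesianProduct⁺ (Unique.allFin⁺ n) (levels-unique (proj₂ x) (proj₂ y)))
    ; ∈-interval⁺          = λ {x} {y} {z} x≤z z≤y → ∈-filter⁺ (λ z → (x ≤ₗ? z) ×-dec (z ≤ₗ? y))
                               (∈-cartesianProduct⁺ (∈-allFin (proj₁ z)) (∈-levels (≤ₗ⇒level≤ x≤z) (≤ₗ⇒level≤ z≤y)))
                               (x≤z , z≤y)
    ; ∈-interval⁻          = λ {x} {y} z∈ → proj₂ (∈-filter⁻ (λ z → (x ≤ₗ? z) ×-dec (z ≤ₗ? y)) {xs = cartesianProduct (allFin n) (levels (proj₂ x) (proj₂ y))} z∈)
    }

LevelEulerian : ∀ {n} → Matrix n → Set
LevelEulerian M = AllIntervalsEulerian (levelPoset M)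

{-# OPTIONS --safe #-}

-- A vanishing sum of signs has an even number of terms, so intervals of positive
-- rank have even size.  Fix u and let d be the period of the closed walks at u.
-- For K large and divisible by d, enlarging [(u,0),(u,2K)] to [(u,0),(u,2K+d)]
-- leaves the first K and the last K+1 levels unchanged and inserts d
-- consecutive levels, which together contain every vertex exactly once.  Hence n
-- is a difference of two even numbers.

module Submission where

open import Defs
open import Data.Bool.Base using (Bool; true; false)
open import Data.Empty using (⊥-elim)
open import Data.Fin.Base as Fin using (Fin)
open import Data.Integer.Base as ℤ using (ℤ; +_; ∣_∣; 0ℤ; 1ℤ; -1ℤ)
import Data.Integer.Properties as ℤ
import Data.Integer.Tactic.RingSolver as ℤ-Solver
open import Data.List.Base using (List; []; _∷_; _++_; length; map; foldr; filter; upTo; applyUpTo; allFin; cartesianProduct)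
import Data.List.Properties as List
open import Data.Nat.Base using (ℕ; zero; suc; NonZero; _+_; _*_; _∸_; _/_; _%_; _≤_; _<_; z≤n; s≤s; >-nonZero)
open import Data.Nat.Divisibility
open import Data.Nat.DivMod using (m≡m%n+[m/n]*n; m%n<n; m*n/n≡m; /-monoˡ-≤)
open import Data.Nat.Induction using (<-rec)
open import Data.Nat.Properties
open import Data.Nat.Tactic.RingSolver using (solve-∀)
open import Data.Product.Base using (_×_; _,_; ∃-syntax; proj₁; proj₂)
open import Data.Sum.Base using (inj₁; inj₂)
open import Function.Base using (_∘_; id)
open import Function.Bundles using (_⇔_; mk⇔; Equivalence)
open import Relation.Binary.PropositionalEquality
open import Relation.Nullary.Decidable using (Dec; does; yes; no; _×-dec_; dec-true; does-⇔; decidable-stable)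
open import Relation.Nullary.Negation.Core using (¬_)
open import Relation.Unary using (Pred; Decidable)
open import Level using (0ℓ)

-- Parity of the number of terms of a sum of signs

sign+1-even : ∀ k → ∃[ q ] sign k ℤ.+ 1ℤ ≡ + 2 ℤ.* q
sign+1-even k = power ∣ k ∣
  where
  power : ∀ m → ∃[ q ] (-1ℤ ℤ.^ m) ℤ.+ 1ℤ ≡ + 2 ℤ.* q
  power zero    = 1ℤ , refl
  power (suc m) with q , eq ← power m =
    1ℤ ℤ.- q , trans (expand (-1ℤ ℤ.^ m)) (trans (cong (λ z → + 2 ℤ.- z) eq) (factor q))
    where
    expand : ∀ x → -1ℤ ℤ.* x ℤ.+ 1ℤ ≡ + 2 ℤ.- (x ℤ.+ 1ℤ)
    expand = ℤ-Solver.solve-∀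
    factor : ∀ q → + 2 ℤ.- + 2 ℤ.* q ≡ + 2 ℤ.* (1ℤ ℤ.- q)
    factor = ℤ-Solver.solve-∀

-- Each sign becomes even after adding 1, and the added ones total `length xs`.
sum-of-signs+length-even : ∀ {A : Set} (f : A → ℤ) xs →
  ∃[ q ] foldr ℤ._+_ 0ℤ (map (sign ∘ f) xs) ℤ.+ + length xs ≡ + 2 ℤ.* q
sum-of-signs+length-even f []       = 0ℤ , refl
sum-of-signs+length-even f (x ∷ xs)
  with q , eq ← sign+1-even (f x) | r , eq′ ← sum-of-signs+length-even f xs =
  q ℤ.+ r , trans (rearrange (sign (f x)) (foldr ℤ._+_ 0ℤ (map (sign ∘ f) xs)) (+ length xs))
              (trans (cong₂ ℤ._+_ eq eq′) (sym (ℤ.*-distribˡ-+ (+ 2) q r)))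
  where
  rearrange : ∀ a b c → (a ℤ.+ b) ℤ.+ (1ℤ ℤ.+ c) ≡ (a ℤ.+ 1ℤ) ℤ.+ (b ℤ.+ c)
  rearrange = ℤ-Solver.solve-∀

sum-of-signs≡0⇒2∣length : ∀ {A : Set} (f : A → ℤ) xs →
  foldr ℤ._+_ 0ℤ (map (sign ∘ f) xs) ≡ 0ℤ → 2 ∣ length xs
sum-of-signs≡0⇒2∣length f xs vanishes with q , eq ← sum-of-signs+length-even f xs =
  divides ∣ q ∣ (trans (cong ∣_∣ length≡2q) (trans (ℤ.abs-* (+ 2) q) (*-comm 2 ∣ q ∣)))
  where
  length≡2q : + length xs ≡ + 2 ℤ.* q
  length≡2q = trans (sym (ℤ.+-identityˡ _)) (trans (cong (ℤ._+ + length xs) (sym vanishes)) eq)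

-- Counting in initial segments of ℕ

indicator : Bool → ℕ
indicator true  = 1
indicator false = 0

count : (ℕ → Bool) → ℕ → ℕ
count f zero    = 0
count f (suc m) = indicator (f 0) + count (f ∘ suc) m

count-+ : ∀ f a b → count f (a + b) ≡ count f a + count (λ k → f (a + k)) b
count-+ f zero    b = refl
count-+ f (suc a) b = trans (cong (_+_ (indicator (f 0))) (count-+ (f ∘ suc) a b))
                            (sym (+-assoc (indicator (f 0)) _ _))

count-cong : ∀ {f g} m → (∀ k → k < m → f k ≡ g k) → count f m ≡ count g m
count-cong zero    f≗g = refl
count-cong (suc m) f≗g = cong₂ _+_ (cong indicator (f≗g 0 (s≤s z≤n)))
                                   (count-cong m (λ k k<m → f≗g (suc k) (s≤s k<m)))

count-false : ∀ {f} m → (∀ k → k < m → f k ≡ false) → count f m ≡ 0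
count-false zero    f-false = refl
count-false (suc m) f-false = cong₂ _+_ (cong indicator (f-false 0 (s≤s z≤n)))
                                        (count-false m (λ k k<m → f-false (suc k) (s≤s k<m)))

count-unique : ∀ {f} m i → i < m → f i ≡ true →
               (∀ k → k < m → f k ≡ true → k ≡ i) → count f m ≡ 1
count-unique {f} (suc m) zero i<m fi unique =
  cong₂ _+_ (cong indicator fi) (count-false m not-later)
  where
  not-later : ∀ k → k < m → f (suc k) ≡ false
  not-later k k<m with f (suc k) in eq
  ... | false = refl
  ... | true with () ← unique (suc k) (s≤s k<m) eq
count-unique {f} (suc m) (suc i) (s≤s i<m) fi unique with f 0 in eq
... | true with () ← unique 0 (s≤s z≤n) eq
... | false = count-unique m i i<m fi
                (λ k k<m fk → suc-injective (unique (suc k) (s≤s k<m) fk))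

length-filter-applyUpTo : ∀ {A : Set} {P : Pred A 0ℓ} (P? : Decidable P) (g : ℕ → A) m →
  length (filter P? (applyUpTo g m)) ≡ count (λ k → does (P? (g k))) m
length-filter-applyUpTo P? g zero    = refl
length-filter-applyUpTo P? g (suc m) with does (P? (g 0))
... | true  = cong suc (length-filter-applyUpTo P? (g ∘ suc) m)
... | false = length-filter-applyUpTo P? (g ∘ suc) m

-- Used with the vertices as `xs` and two ranges of levels as `ys` and `zs`: an excess of one
-- element over each vertex adds up to the number of vertices.
length-filter-cartesianProduct : ∀ {A B : Set} {P Q : Pred (A × B) 0ℓ}
  (P? : Decidable P) (Q? : Decidable Q) (ys zs : List B) →
  (∀ x → length (filter Q? (map (x ,_) zs)) ≡ 1 + length (filter P? (map (x ,_) ys))) →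
  ∀ xs → length (filter Q? (cartesianProduct xs zs)) ≡
         length xs + length (filter P? (cartesianProduct xs ys))
length-filter-cartesianProduct P? Q? ys zs fibre []       = refl
length-filter-cartesianProduct P? Q? ys zs fibre (x ∷ xs) = begin
  length (filter Q? (map (x ,_) zs ++ cartesianProduct xs zs))
    ≡⟨ split Q? (map (x ,_) zs) _ ⟩
  length (filter Q? (map (x ,_) zs)) + length (filter Q? (cartesianProduct xs zs))
    ≡⟨ cong₂ _+_ (fibre x) (length-filter-cartesianProduct P? Q? ys zs fibre xs) ⟩
  suc (length (filter P? (map (x ,_) ys))) + (length xs + length (filter P? (cartesianProduct xs ys)))
    ≡⟨ rearrange (length (filter P? (map (x ,_) ys))) (length xs) _ ⟩
  suc (length xs) + (length (filter P? (map (x ,_) ys)) + length (filter P? (cartesianProduct xs ys)))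
    ≡⟨ cong (_+_ (suc (length xs))) (split P? (map (x ,_) ys) _) ⟨
  suc (length xs) + length (filter P? (map (x ,_) ys ++ cartesianProduct xs ys)) ∎
  where
  open ≡-Reasoning
  split : ∀ {C : Set} {R : Pred C 0ℓ} (R? : Decidable R) us vs →
          length (filter R? (us ++ vs)) ≡ length (filter R? us) + length (filter R? vs)
  split R? us vs = trans (cong length (List.filter-++ R? us vs)) (List.length-++ (filter R? us))
  rearrange : ∀ a b c → suc a + (b + c) ≡ suc b + (a + c)
  rearrange = solve-∀

∣m+n∣n⇒∣m : ∀ {d m n} → d ∣ m + n → d ∣ n → d ∣ m
∣m+n∣n⇒∣m {d} {m} {n} d∣m+n = ∣m+n∣m⇒∣n (subst (d ∣_) (+-comm m n) d∣m+n)

count-∣ : ∀ d → .{{_ : NonZero d}} → ∀ s → count (λ i → does (d ∣? i + s)) d ≡ 1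
count-∣ d@(suc e) s = count-unique d r (m%n<n (e * s) d) (dec-true (d ∣? r + s) d∣r+s)
                        (λ k k<d eq → unique k k<d (from-true (d ∣? k + s) eq))
  where
  -- Since `e` is `d - 1`, `e * s` is congruent to `- s` modulo `d`, so its remainder solves
  -- `d ∣ r + s`.
  r = (e * s) % d
  q = (e * s) / d
  from-true : ∀ {A : Set} (a? : Dec A) → does a? ≡ true → A
  from-true (yes a) eq = a
  d∣r+s : d ∣ r + s
  d∣r+s = ∣m+n∣m⇒∣n (subst (d ∣_) eq (m∣m*n {d} s)) (n∣m*n q {d})
    where
    rearrange : ∀ s r x → s + (r + x) ≡ x + (r + s)
    rearrange = solve-∀
    eq : d * s ≡ q * d + (r + s)
    eq = trans (cong (_+_ s) (m≡m%n+[m/n]*n (e * s) d)) (rearrange s r (q * d))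
  ≤-unique : ∀ i j → i ≤ j → j < d → d ∣ i + s → d ∣ j + s → i ≡ j
  ≤-unique i j i≤j j<d d∣i d∣j with m≤n⇒∃[o]m+o≡n i≤j
  ... | zero  , refl = sym (+-identityʳ i)
  ... | suc l , refl = ⊥-elim (<⇒≱ j<d (≤-trans (∣⇒≤ d∣k) (m≤n+m (suc l) i)))
    where
    rearrange : ∀ i k s → (i + k) + s ≡ (i + s) + k
    rearrange = solve-∀
    d∣k : d ∣ suc l
    d∣k = ∣m+n∣m⇒∣n (subst (d ∣_) (rearrange i (suc l) s) d∣j) d∣i
  unique : ∀ k → k < d → d ∣ k + s → k ≡ r
  unique k k<d d∣k with ≤-total k r
  ... | inj₁ k≤r = ≤-unique k r k≤r (m%n<n (e * s) d) d∣k d∣r+s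
  ... | inj₂ r≤k = sym (≤-unique r k r≤k k<d d∣r+s d∣k)

-- The period of an additive submonoid of ℕ

module _ (C : ℕ → Set) (C-zero : C 0) (C-+ : ∀ {a b} → C a → C b → C (a + b)) where

  -- Such a `d` is the gcd of `C`. The second component is the form in which it is used: all
  -- sufficiently large multiples of `d` occur.
  IsPeriod : ℕ → Set
  IsPeriod d = (∀ c → C c → d ∣ c) × ∃[ B ] (∀ k → B ≤ k → d ∣ k → C k)

  C-* : ∀ k {a} → C a → C (k * a)
  C-* zero    Ca = C-zero
  C-* (suc k) Ca = C-+ Ca (C-* k Ca)

  -- With a = m d, every multiple j d with j = r + (r + s) m is s a + r (a + d).
  difference⇒IsPeriod : ∀ d → .{{_ : NonZero d}} → ∀ a → 0 < a → C a → C (a + d) →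
                        (∀ c → C c → d ∣ c) → IsPeriod d
  difference⇒IsPeriod d a 0<a Ca Ca+d d∣C with d∣C a Ca
  ... | divides zero    refl with () ← 0<a
  ... | divides m@(suc _) refl = d∣C , m * m * d , large
    where
    combine : ∀ r s m d → s * (m * d) + r * (m * d + d) ≡ (r + (r + s) * m) * d
    combine = solve-∀
    large : ∀ k → m * m * d ≤ k → d ∣ k → C k
    large _ B≤k (divides j refl) = subst C (sym k≡) (C-+ (C-* s Ca) (C-* (j % m) Ca+d))
      where
      -- The bound `m * m * d` serves this inequality: it forces the quotient to be at least `m`,
      -- above any remainder, so the truncated subtraction in `s` is exact.
      r≤q : j % m ≤ j / m
      r≤q = ≤-trans (<⇒≤ (m%n<n j m)) (subst (_≤ j / m) (m*n/n≡m m m) (/-monoˡ-≤ m (*-cancelʳ-≤ (m * m) j d B≤k)))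
      s = j / m ∸ j % m
      k≡ : j * d ≡ s * (m * d) + j % m * (m * d + d)
      k≡ = trans (cong (_* d) (trans (m≡m%n+[m/n]*n j m) (cong (λ q → j % m + q * m) (sym (m+[n∸m]≡n r≤q)))))
                 (sym (combine (j % m) s m d))

  -- A difference d of two elements is the period unless some element c leaves a
  -- remainder r > 0 modulo d, and then r is a smaller difference.  Whether such
  -- a c exists is not decidable, hence the double negation.
  ¬¬period : ∀ {t} → 0 < t → C t → ¬ ¬ (∃[ d ] (0 < d × IsPeriod d))
  ¬¬period {t} 0<t Ct ¬period =
    -- The descent starts from the difference `t` of the elements `t + t` and `t`.
    <-rec (λ d → 0 < d → ∀ a → 0 < a → C a → ¬ C (a + d)) descend t 0<t t 0<t Ct (C-+ Ct Ct)
    where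
    descend : ∀ d → (∀ {r} → r < d → 0 < r → ∀ a → 0 < a → C a → ¬ C (a + r)) →
              0 < d → ∀ a → 0 < a → C a → ¬ C (a + d)
    descend d@(suc _) smaller 0<d a 0<a Ca Ca+d =
      ¬period (d , 0<d , difference⇒IsPeriod d a 0<a Ca Ca+d divisible)
      where
      divisible : ∀ c → C c → d ∣ c
      divisible c Cc with c % d | m%n<n c d | m≡m%n+[m/n]*n c d
      ... | zero      | _   | eq = divides (c / d) eq
      ... | r@(suc _) | r<d | eq = ⊥-elim
        -- As `c` equals `r + q * d`, the elements `a + q * (a + d)` and `(a + q * a) + c` differ by
        -- exactly `r`.
        (smaller r<d (s≤s z≤n) (a + q * (a + d)) (≤-trans 0<a (m≤m+n a _))
          (C-+ Ca (C-* q Ca+d))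
          (subst C (trans (cong (λ x → (a + q * a) + x) eq) (rearrange a q d r))
            (C-+ (C-+ Ca (C-* q Ca)) Cc)))
        where
        q = c / d
        rearrange : ∀ a q d r → (a + q * a) + (r + q * d) ≡ (a + q * (a + d)) + r
        rearrange = solve-∀

-- Walks of a matrix and intervals of its level poset

≤-sum : ∀ {n} (f : Fin n → ℕ) i → f i ≤ sum f
≤-sum f Fin.zero    = m≤m+n _ _
≤-sum f (Fin.suc i) = ≤-trans (≤-sum (f ∘ Fin.suc) i) (m≤n+m _ (f Fin.zero))

module _ {n : ℕ} (M : Matrix n) where

  Walk : ℕ → Fin n → Fin n → Set
  Walk k u v = 0 < (M ⊛^ k) u v

  -- Equality is the case of a walk of length 0, because the zeroth power is the identity matrix;
  -- the two cases of the order thus merge into one condition.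
  ≤ₗ⇔Walk : ∀ {u v i j} k → i ℤ.+ + k ≡ j → _≤ₗ_ M (u , i) (v , j) ⇔ Walk k u v
  ≤ₗ⇔Walk {u} {v} {i} k refl = mk⇔ to (from k)
    where
    to : _≤ₗ_ M (u , i) (v , i ℤ.+ + k) → Walk k u v
    to (inj₁ (_ , p)) = subst (λ l → Walk l u v) (∣[i+m]-i∣ i k) p
    to (inj₂ eq)      = subst (λ l → Walk l u v) 0≡k (subst (Walk 0 u) (cong proj₁ eq) (identity-pos⁺ u))
      where
      0≡k : 0 ≡ k
      0≡k = trans (cong ∣_∣ (sym (ℤ.+-inverseʳ i)))
              (trans (cong (λ z → ∣ z ℤ.- i ∣) (cong proj₂ eq)) (∣[i+m]-i∣ i k))
    from : ∀ k → Walk k u v → _≤ₗ_ M (u , i) (v , i ℤ.+ + k)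
    from zero    p = inj₂ (cong₂ _,_ (identity-pos⁻ u v p) (sym (ℤ.+-identityʳ i)))
    from (suc k) p = inj₁ ( subst (ℤ._< i ℤ.+ + suc k) (ℤ.+-identityʳ i) (ℤ.+-monoʳ-< i (ℤ.+<+ (s≤s z≤n)))
                          , subst (λ l → Walk l u v) (sym (∣[i+m]-i∣ i (suc k))) p)

  -- This is the filter of `levelInterval`, so that intervals unfold definitionally to products
  -- filtered by it.
  inInterval? : ∀ x y → Decidable (λ z → _≤ₗ_ M x z × _≤ₗ_ M z y)
  inInterval? x y z = (_≤ₗ?_ M x z) ×-dec (_≤ₗ?_ M z y)

  interval⇔ : ∀ {u v w p} a b → a + b ≡ p →
    (_≤ₗ_ M (u , 0ℤ) (w , 0ℤ ℤ.+ + a) × _≤ₗ_ M (w , 0ℤ ℤ.+ + a) (v , + p)) ⇔ (Walk a u w × Walk b w v)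
  interval⇔ {u} {v} {w} a b refl = mk⇔
    (λ (l , r) → Equivalence.to (≤ₗ⇔Walk a refl) l , Equivalence.to (≤ₗ⇔Walk b refl) r)
    (λ (l , r) → Equivalence.from (≤ₗ⇔Walk a refl) l , Equivalence.from (≤ₗ⇔Walk b refl) r)

  onLevel : Fin n → Fin n → ℕ → Fin n → ℕ → Bool
  onLevel u v p w k = does (inInterval? (u , 0ℤ) (v , + p) (w , 0ℤ ℤ.+ + k))

  length-fibre : ∀ u v p w →
    length (filter (inInterval? (u , 0ℤ) (v , + p)) (map (w ,_) (levels 0ℤ (+ p)))) ≡
    count (onLevel u v p w) (suc p)
  length-fibre u v p w = trans
    (cong (length ∘ filter P?) (begin
      map (w ,_) (map (λ k → 0ℤ ℤ.+ + k) (upTo (suc ∣ + p ℤ.- 0ℤ ∣)))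
        ≡⟨ List.map-∘ (upTo (suc ∣ + p ℤ.- 0ℤ ∣)) ⟨
      map (λ k → w , 0ℤ ℤ.+ + k) (upTo (suc ∣ + p ℤ.- 0ℤ ∣))
        ≡⟨ cong (λ z → map (λ k → w , 0ℤ ℤ.+ + k) (upTo (suc ∣ z ∣))) (ℤ.+-identityʳ (+ p)) ⟩
      map (λ k → w , 0ℤ ℤ.+ + k) (upTo (suc p))
        ≡⟨ List.map-upTo _ (suc p) ⟩
      applyUpTo (λ k → w , 0ℤ ℤ.+ + k) (suc p) ∎))
    (length-filter-applyUpTo P? (λ k → w , 0ℤ ℤ.+ + k) (suc p))
    where
    open ≡-Reasoning
    P? = inInterval? (u , 0ℤ) (v , + p)

  interval-even : LevelEulerian M → ∀ u v p → 0 < p → Walk p u v →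
                  2 ∣ length (levelInterval M (u , 0ℤ) (v , + p))
  interval-even eulerian u v p 0<p walk =
    sum-of-signs≡0⇒2∣length proj₂ (levelInterval M x y)
      (eulerian x y x≤y x y (inj₂ refl) x≤y (inj₂ refl)
        (subst (1ℤ ℤ.≤_) (sym (ℤ.+-identityʳ (+ p))) (ℤ.+≤+ 0<p)))
    where
    x = u , 0ℤ
    y = v , + p
    x≤y : _≤ₗ_ M x y
    x≤y = Equivalence.from (≤ₗ⇔Walk p refl) walk

  -- Long walks from and to a vertex `u` of period `d`

  module _ (indecomposable : Indecomposable M) (u : Fin n)
           (d : ℕ) (0<d : 0 < d)
           (period : IsPeriod (λ k → Walk k u u) (identity-pos⁺ u) (λ {a} {b} → ⊛^-pos M a b) d) where

    to from : Fin n → ℕ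
    to   w = proj₁ (indecomposable u w)
    from w = proj₁ (indecomposable w u)

    to-walk : ∀ w → Walk (to w) u w
    to-walk w = proj₂ (proj₂ (indecomposable u w))

    from-walk : ∀ w → Walk (from w) w u
    from-walk w = proj₂ (proj₂ (indecomposable w u))

    B : ℕ
    B = proj₁ (proj₂ period)

    -- The sum bounds every `to w + from w` at once, `suc` makes `S` positive, and the factor `d`
    -- makes `K` a multiple of the period.
    S K : ℕ
    S = sum (λ w → to w + from w) + suc B
    K = S * d

    closed : ∀ k → B ≤ k → d ∣ k → Walk k u u
    closed = proj₂ (proj₂ period)

    d∣to+from : ∀ w → d ∣ to w + from w
    d∣to+from w = proj₁ period _ (⊛^-pos M (to w) (from w) (to-walk w) (from-walk w))

    S≤K : S ≤ K
    S≤K = m≤m*n S d {{>-nonZero 0<d}}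

    to+from+B≤K : ∀ w → to w + from w + B ≤ K
    to+from+B≤K w = ≤-trans (+-mono-≤ (≤-sum (λ w → to w + from w) w) (n≤1+n B)) S≤K

    walk⇒∣from : ∀ w k → Walk k u w → d ∣ k + from w
    walk⇒∣from w k p = proj₁ period _ (⊛^-pos M k (from w) p (from-walk w))

    walk⇒∣to : ∀ w k → Walk k w u → d ∣ to w + k
    walk⇒∣to w k p = proj₁ period _ (⊛^-pos M (to w) k (to-walk w) p)

    -- The walk is a closed walk at `u` of length `k - to w` followed by the chosen walk to `w`.
    -- That length is at least `B`, and `d` divides it since adding `to w + from w` to it gives
    -- `k + from w`.
    ∣from⇒walk : ∀ w k → K ≤ k → d ∣ k + from w → Walk k u w
    ∣from⇒walk w k K≤k d∣ with l , refl ← m≤n⇒∃[o]m+o≡n (≤-trans (to+from+B≤K w) K≤k) =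
      subst (λ m → Walk m u w) (rearrange (to w) (from w) B l)
        (⊛^-pos M (from w + (B + l)) (to w)
          (closed _ (≤-trans (m≤m+n B l) (m≤n+m _ (from w)))
            (∣m+n∣m⇒∣n (subst (d ∣_) (rearrange′ (to w) (from w) B l) d∣) (d∣to+from w)))
          (to-walk w))
      where
      rearrange : ∀ t f B l → (f + (B + l)) + t ≡ t + f + B + l
      rearrange = solve-∀
      rearrange′ : ∀ t f B l → (t + f + B + l) + f ≡ (t + f) + (f + (B + l))
      rearrange′ = solve-∀

    ∣to⇒walk : ∀ w k → K ≤ k → d ∣ to w + k → Walk k w u
    ∣to⇒walk w k K≤k d∣ with l , refl ← m≤n⇒∃[o]m+o≡n (≤-trans (to+from+B≤K w) K≤k) =
      subst (λ m → Walk m w u) (rearrange (to w) (from w) B l)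
        (⊛^-pos M (from w) (to w + (B + l)) (from-walk w)
          (closed _ (≤-trans (m≤m+n B l) (m≤n+m _ (to w)))
            (∣m+n∣m⇒∣n (subst (d ∣_) (rearrange′ (to w) (from w) B l) d∣) (d∣to+from w))))
      where
      rearrange : ∀ t f B l → f + (t + (B + l)) ≡ t + f + B + l
      rearrange = solve-∀
      rearrange′ : ∀ t f B l → t + (t + f + B + l) ≡ (t + f) + (t + (B + l))
      rearrange′ = solve-∀

    -- Makes the congruence for walks of length `a` from `u` to `w` equivalent to the one for walks
    -- of length `b` back.
    ∣complementary : ∀ w a b → d ∣ a + b → d ∣ (a + from w) + (to w + b)
    ∣complementary w a b d∣ =
      subst (d ∣_) (rearrange a b (to w) (from w)) (∣m∣n⇒∣m+n d∣ (d∣to+from w))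
      where
      rearrange : ∀ a b t f → (a + b) + (t + f) ≡ (a + f) + (t + b)
      rearrange = solve-∀

    -- A walk of length `a` to `w` forces the congruence for the way back, and `K ≤ b` then supplies
    -- that walk. Membership therefore depends on `a` alone.
    onLevel-lower : ∀ w a b → d ∣ a + b → K ≤ b →
                    onLevel u u (a + b) w a ≡ does (0 <? (M ⊛^ a) u w)
    onLevel-lower w a b d∣ K≤b = does-⇔ (mk⇔
      (proj₁ ∘ Equivalence.to (interval⇔ a b refl))
      (λ p → Equivalence.from (interval⇔ a b refl)
        (p , ∣to⇒walk w b K≤b (∣m+n∣m⇒∣n (∣complementary w a b d∣) (walk⇒∣from w a p)))))
      (inInterval? (u , 0ℤ) (u , + (a + b)) (w , 0ℤ ℤ.+ + a))
      (0 <? (M ⊛^ a) u w)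

    onLevel-upper : ∀ w a b → d ∣ a + b → K ≤ a →
                    onLevel u u (a + b) w a ≡ does (0 <? (M ⊛^ b) w u)
    onLevel-upper w a b d∣ K≤a = does-⇔ (mk⇔
      (proj₂ ∘ Equivalence.to (interval⇔ a b refl))
      (λ p → Equivalence.from (interval⇔ a b refl)
        (∣from⇒walk w a K≤a (∣m+n∣n⇒∣m (∣complementary w a b d∣) (walk⇒∣to w b p)) , p)))
      (inInterval? (u , 0ℤ) (u , + (a + b)) (w , 0ℤ ℤ.+ + a))
      (0 <? (M ⊛^ b) w u)

    onLevel-middle : ∀ w a b → d ∣ a + b → K ≤ a → K ≤ b →
                     onLevel u u (a + b) w a ≡ does (d ∣? a + from w)
    onLevel-middle w a b d∣ K≤a K≤b = trans (onLevel-lower w a b d∣ K≤b)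
      (does-⇔ (mk⇔ (walk⇒∣from w a) (∣from⇒walk w a K≤a))
        (0 <? (M ⊛^ a) u w) (d ∣? a + from w))

    -- Comparison of the intervals of rank `p` and `q`

    p q : ℕ
    p = K + K
    q = d + (K + K)

    d∣p : d ∣ p
    d∣p = ∣m∣n⇒∣m+n (n∣m*n S) (n∣m*n S)

    d∣q : d ∣ q
    d∣q = ∣m∣n⇒∣m+n ∣-refl d∣p

    -- The facts about `onLevel` concern intervals whose rank is literally `a + b`; this transfers
    -- them to rank `p` or `q`.
    at : ∀ {w a f} r b → d ∣ r → a + b ≡ r →
         (d ∣ a + b → onLevel u u (a + b) w a ≡ f) → onLevel u u r w a ≡ f
    at r b d∣r refl eq = eq d∣r

    lower-equal : ∀ w k → k < K → onLevel u u q w k ≡ onLevel u u p w k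
    lower-equal w k k<K with l , k+l≡K ← m≤n⇒∃[o]m+o≡n (<⇒≤ k<K) = trans
      (at q (l + (d + K)) d∣q
        (trans (sym (+-assoc k l _)) (trans (cong (_+ (d + K)) k+l≡K) (rearrange d K)))
        (λ d∣ → onLevel-lower w k _ d∣ (≤-trans (m≤n+m K d) (m≤n+m _ l))))
      (sym (at p (l + K) d∣p (trans (sym (+-assoc k l K)) (cong (_+ K) k+l≡K))
        (λ d∣ → onLevel-lower w k _ d∣ (m≤n+m K l))))
      where
      rearrange : ∀ d K → K + (d + K) ≡ d + (K + K)
      rearrange = solve-∀

    -- Both levels lie `K - k` below the top of their interval. The bound `suc K` includes the top
    -- level itself.
    upper-equal : ∀ w k → k < suc K → onLevel u u q w (K + (d + k)) ≡ onLevel u u p w (K + k)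
    upper-equal w k (s≤s k≤K) with l , k+l≡K ← m≤n⇒∃[o]m+o≡n k≤K = trans
      (at q l d∣q (trans (rearrange d K k l) (cong (λ x → d + (K + x)) k+l≡K))
        (λ d∣ → onLevel-upper w (K + (d + k)) l d∣ (m≤m+n K _)))
      (sym (at p l d∣p (trans (+-assoc K k l) (cong (_+_ K) k+l≡K))
        (λ d∣ → onLevel-upper w (K + k) l d∣ (m≤m+n K k))))
      where
      rearrange : ∀ d K k l → (K + (d + k)) + l ≡ d + (K + (k + l))
      rearrange = solve-∀

    -- These levels are at distance at least `K` from both ends, so membership is a congruence
    -- modulo `d`, met once among `d` consecutive levels.
    middle-once : ∀ w → count (λ k → onLevel u u q w (K + k)) d ≡ 1
    middle-once w = trans (count-cong d middle) (count-∣ d {{>-nonZero 0<d}} (K + from w))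
      where
      middle : ∀ k → k < d → onLevel u u q w (K + k) ≡ does (d ∣? k + (K + from w))
      middle k k<d with l , k+l≡d ← m≤n⇒∃[o]m+o≡n (<⇒≤ k<d) = trans
        (at q (l + K) d∣q (trans (rearrange K k l) (cong (_+ (K + K)) k+l≡d))
          (λ d∣ → onLevel-middle w (K + k) _ d∣ (m≤m+n K k) (m≤n+m K l)))
        (cong (λ x → does (d ∣? x)) (rearrange′ K k (from w)))
        where
        rearrange : ∀ K k l → (K + k) + (l + K) ≡ (k + l) + (K + K)
        rearrange = solve-∀
        rearrange′ : ∀ K k f → (K + k) + f ≡ k + (K + f)
        rearrange′ = solve-∀

    -- The levels split into blocks of sizes `K`, `d`, `suc K` for `q` and `K`, `suc K` for `p`. The
    -- outer blocks agree and the middle one contributes 1.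
    count-fibre : ∀ w → count (onLevel u u q w) (suc q) ≡ 1 + count (onLevel u u p w) (suc p)
    count-fibre w = begin
      count f (suc (d + (K + K)))
        ≡⟨ cong (count f) (rearrange d K) ⟩
      count f (K + (d + suc K))
        ≡⟨ count-+ f K (d + suc K) ⟩
      count f K + count (λ k → f (K + k)) (d + suc K)
        ≡⟨ cong (_+_ (count f K)) (count-+ (λ k → f (K + k)) d (suc K)) ⟩
      count f K + (count (λ k → f (K + k)) d + count (λ k → f (K + (d + k))) (suc K))
        ≡⟨ cong₂ _+_ (count-cong K (lower-equal w))
                     (cong₂ _+_ (middle-once w) (count-cong (suc K) (upper-equal w))) ⟩
      count g K + (1 + count (λ k → g (K + k)) (suc K))
        ≡⟨ +-suc (count g K) _ ⟩
      1 + (count g K + count (λ k → g (K + k)) (suc K))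
        ≡⟨ cong suc (count-+ g K (suc K)) ⟨
      1 + count g (K + suc K)
        ≡⟨ cong (λ m → 1 + count g m) (+-suc K K) ⟩
      1 + count g (suc (K + K)) ∎
      where
      open ≡-Reasoning
      f = onLevel u u q w
      g = onLevel u u p w
      rearrange : ∀ d K → suc (d + (K + K)) ≡ K + (d + suc K)
      rearrange = solve-∀

    0<K : 0 < K
    0<K = ≤-trans (≤-trans (s≤s z≤n) (m≤n+m (suc B) (sum (λ w → to w + from w)))) S≤K

    B≤p : B ≤ p
    B≤p = ≤-trans (≤-trans (m≤n+m B (to u + from u)) (to+from+B≤K u)) (m≤m+n K K)

    length-interval : length (levelInterval M (u , 0ℤ) (u , + q)) ≡
                      n + length (levelInterval M (u , 0ℤ) (u , + p))
    length-interval = trans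
      (length-filter-cartesianProduct (inInterval? (u , 0ℤ) (u , + p)) (inInterval? (u , 0ℤ) (u , + q))
        (levels 0ℤ (+ p)) (levels 0ℤ (+ q))
        (λ w → trans (length-fibre u u q w)
                 (trans (count-fibre w) (cong suc (sym (length-fibre u u p w)))))
        (allFin n))
      (cong (_+ length (levelInterval M (u , 0ℤ) (u , + p))) (List.length-tabulate id))

    order-even : LevelEulerian M → 2 ∣ n
    order-even eulerian = ∣m+n∣n⇒∣m
      (subst (2 ∣_) length-interval
        (interval-even eulerian u u q 0<q (closed q (≤-trans B≤p (m≤n+m p d)) d∣q)))
      (interval-even eulerian u u p 0<p (closed p B≤p d∣p))
      where
      0<p : 0 < p
      0<p = ≤-trans 0<K (m≤m+n K K)
      0<q : 0 < q
      0<q = ≤-trans 0<p (m≤n+m p d)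

theorem4p9 : (n : ℕ) → .{{_ : NonZero n}} → (M : Matrix n) → IsBinary M →
    LevelEulerian M → Indecomposable M → 2 ∣ n
-- The period is available only under a double negation, which suffices because divisibility by 2 is
-- decidable.
theorem4p9 (suc n) M _ eulerian indecomposable = decidable-stable (2 ∣? suc n) λ ¬even →
  let u = Fin.zero
      t , 0<t , closed-walk = indecomposable u u
  in ¬¬period (λ k → Walk M k u u) (identity-pos⁺ u) (λ {a} {b} → ⊛^-pos M a b) 0<t closed-walk
       λ (d , 0<d , period) → ¬even (order-even M indecomposable u d 0<d period eulerian)
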